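{- Let $p>3$ be a prime. Then for each $r\in\mathbb{N}$ there is a $p$-adic integer $c_r$, depending only on $r$, such that $$\sum_{k=0}^{p-1}(2k+1)^{2r+1}A_k\equiv c_r\, p \pmod {p^3}.$$
   Context: $A_n=\sum_{k=0}^{n}\binom{n}{k}^2\binom{n+k}{k}^2$ are the Apéry numbers; $\mathbb{N}=\{0,1,2,\dots\}$. -}

module Defs where

open import Data.Nat using (ℕ; suc; _+_; _*_; _^_)
open import Data.Nat.Combinatorics using (_C_)
open import Data.Nat.Divisibility using (_∣_)
open import Data.List using (map; upTo)
open import Data.Nat.ListAction using (sum)
open import Data.Integer as ℤ using (ℤ; +_)
open import Data.Rational as ℚ using (ℚ; ↥_; ↧ₙ_; _/_)
open import Relation.Nullary using (¬_)

sumBelow : ℕ → (ℕ → ℕ) → ℕ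
sumBelow n f = sum (map f (upTo n))

apery : ℕ → ℕ
apery n = sumBelow (suc n) (λ k → ((n C k) ^ 2) * (((n + k) C k) ^ 2))

ℕtoℚ : ℕ → ℚ
ℕtoℚ n = (+ n) / 1

IsPAdicInt : ℕ → ℚ → Set
IsPAdicInt p x = ¬ (p ∣ ↧ₙ x)

CongModPow : ℕ → ℕ → ℚ → ℚ → Set
CongModPow p m x y = ((p ^ m) ∣ ℤ.∣ ↥ (x ℚ.- y) ∣) × IsPAdicInt p (x ℚ.- y)
  where open import Data.Product using (_×_)

{-# OPTIONS --safe #-}
-- The Apéry recurrence is a second-order operator with cubic coefficients. Summation by
-- parts against a polynomial multiplier x shows that Σ_{k<n} (L*x)(k) A_k, for the adjoint
-- operator L*, is n³ times an integer. For x(k) = (2k+1)^(2s) the image 4 L*x is an odd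
-- polynomial in y = 2k+1 with leading term −16 y^(2s+3), so modulo n³ and up to powers of 2
-- every odd moment of A_k is a multiple of the first one, Σ (2k+1) A_k. For an odd prime
-- n = p the latter is p modulo p³: exchanging the sums and telescoping over k turns it into
-- Σ_j p² D_j²/(2j+1) with D_j = C(p−1,j) C(p+j,j) ≡ ±1 (mod p²), where the terms j and
-- p−1−j cancel and the middle one, 2j+1 = p, contributes p.
module Submission where

open import Defs
open import Data.Nat using (ℕ; zero; suc; z≤n; s≤s)
import Data.Nat as ℕ
import Data.Nat.Properties as ℕ
import Data.Nat.Divisibility as ℕ
import Data.Nat.Coprimality as Coprime
open import Data.Nat.Combinatorics using (_C_; nCk+nC[k+1]≡[n+1]C[k+1]; k>n⇒nCk≡0)
open import Data.Nat.ListAction using (sum)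
open import Data.Nat.ListAction.Properties using (sum-++)
open import Data.Nat.Primality using (Prime; euclidsLemma; prime⇒nonZero; prime⇒irreducible)
open import Data.Integer as ℤ using (ℤ; +_)
import Data.Integer.Properties as ℤ
open import Data.Integer.Divisibility.Signed as ℤ using (divides; ∣ᵤ⇒∣; ∣⇒∣ᵤ; ∣m∣n⇒∣m+n; ∣m∣n⇒∣m-n; ∣m⇒∣m*n)
open import Data.Integer.Tactic.RingSolver using (solve-∀)
open import Data.List using (map; upTo; _∷ʳ_; _∷_; [])
open import Data.List.Properties using (upTo-∷ʳ; map-++)
open import Data.Product using (Σ; _×_; _,_)
open import Data.Rational as ℚ using (ℚ; mkℚ; ↥_; ↧_; ↧ₙ_)
import Data.Rational.Properties as ℚ
open import Data.Rational.Unnormalised as ℚᵘ using (mkℚᵘ; *≡*)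
import Data.Rational.Unnormalised.Properties as ℚᵘ
open import Data.Sum using (_⊎_; inj₁; inj₂)
open import Function using (_∘_)
open import Relation.Nullary using (¬_; contradiction)
open import Relation.Binary.PropositionalEquality
open ≡-Reasoning

-- The descent in degree succeeds because its pivot is a power of 2 up to sign. The recurrence has
-- characteristic polynomial x² - 34x + 1, whose value at 1 is -32; the scaling 4 · k³ ~ y³/2 turns
-- this into -16. Inverting it brings in powers of 2 and no other prime, so the descent ends with a
-- constant c / 2^M that is p-adically integral for every odd p. Both c and M are found over ℤ
-- before any n or p is named, which is why c_r depends on r alone. The natural formulas are full of
-- fractions: ratios of binomials, D_j²/(2j+1), inverses of j². They are replaced by integer
-- identities with the denominators multiplied out. A factor prime to p is then cancelled from a
-- divisibility by p^k, and a factor independent of p from an equation. Rationals enter only when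
-- c_r is finally formed.

module IntegerSums where

  open import Data.Integer using (_+_; _*_; _-_; -_; _^_; 0ℤ; 1ℤ; ≢-nonZero) renaming (∣_∣ to abs)
  open import Data.Integer.Divisibility.Signed using (_∣_)

  -- Finite sums of integers.

  ∑ : ℕ → (ℕ → ℤ) → ℤ
  ∑ zero    f = 0ℤ
  ∑ (suc n) f = ∑ n f + f n

  ∑-cong-< : ∀ n {f g} → (∀ k → k ℕ.< n → f k ≡ g k) → ∑ n f ≡ ∑ n g
  ∑-cong-< zero    eq = refl
  ∑-cong-< (suc n) eq = cong₂ _+_ (∑-cong-< n (λ k k<n → eq k (ℕ.m<n⇒m<1+n k<n))) (eq n (ℕ.n<1+n n))

  ∑-cong : ∀ n {f g} → (∀ k → f k ≡ g k) → ∑ n f ≡ ∑ n g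
  ∑-cong n eq = ∑-cong-< n (λ k _ → eq k)

  ∑-zero : ∀ n → ∑ n (λ _ → 0ℤ) ≡ 0ℤ
  ∑-zero zero    = refl
  ∑-zero (suc n) = trans (ℤ.+-identityʳ _) (∑-zero n)

  ∑-+ : ∀ n f g → ∑ n (λ k → f k + g k) ≡ ∑ n f + ∑ n g
  ∑-+ zero    f g = refl
  ∑-+ (suc n) f g = trans (cong (_+ (f n + g n)) (∑-+ n f g)) (interchange (∑ n f) (∑ n g) (f n) (g n))
    where
    interchange : ∀ a b c d → a + b + (c + d) ≡ a + c + (b + d)
    interchange = solve-∀

  ∑-*ˡ : ∀ n c f → ∑ n (λ k → c * f k) ≡ c * ∑ n f
  ∑-*ˡ zero    c f = sym (ℤ.*-zeroʳ c)
  ∑-*ˡ (suc n) c f = trans (cong (_+ c * f n) (∑-*ˡ n c f)) (sym (ℤ.*-distribˡ-+ c (∑ n f) (f n)))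

  ∑-swap : ∀ m n (f : ℕ → ℕ → ℤ) → ∑ m (λ i → ∑ n (f i)) ≡ ∑ n (λ j → ∑ m (λ i → f i j))
  ∑-swap zero    n f = sym (∑-zero n)
  ∑-swap (suc m) n f = trans (cong (_+ ∑ n (f m)) (∑-swap m n f)) (sym (∑-+ n (λ j → ∑ m (λ i → f i j)) (f m)))

  ∑-headTail : ∀ n f → ∑ (suc n) f ≡ f 0 + ∑ n (f ∘ suc)
  ∑-headTail zero    f = trans (ℤ.+-identityˡ (f 0)) (sym (ℤ.+-identityʳ (f 0)))
  ∑-headTail (suc n) f = trans (cong (_+ f (suc n)) (∑-headTail n f)) (ℤ.+-assoc (f 0) (∑ n (f ∘ suc)) (f (suc n)))

  -- Allows sums with different supports to be taken over one common range. The order `≤′` grows at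
  -- the upper end, where `∑` splits off its last term.
  ∑-extend : ∀ {m n} f → m ℕ.≤′ n → (∀ k → m ℕ.≤ k → f k ≡ 0ℤ) → ∑ m f ≡ ∑ n f
  ∑-extend f ℕ.≤′-refl         f≡0 = refl
  ∑-extend {m} {suc n} f (ℕ.≤′-step m≤′n) f≡0 = begin
    ∑ m f        ≡⟨ ∑-extend f m≤′n f≡0 ⟩
    ∑ n f        ≡⟨ ℤ.+-identityʳ (∑ n f) ⟨
    ∑ n f + 0ℤ   ≡⟨ cong (λ t → ∑ n f + t) (f≡0 n (ℕ.≤′⇒≤ m≤′n)) ⟨
    ∑ n f + f n  ∎

  ∑-telescope : ∀ (f g : ℕ → ℤ) → f 0 ≡ g 0 → (∀ k → f (suc k) ≡ g (suc k) - g k) → ∀ n → ∑ (suc n) f ≡ g n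
  ∑-telescope f g f₀ f₊ zero    = trans (ℤ.+-identityˡ (f 0)) f₀
  ∑-telescope f g f₀ f₊ (suc n) = trans (cong₂ _+_ (∑-telescope f g f₀ f₊ n) (f₊ n)) (collapse (g n) (g (suc n)))
    where
    collapse : ∀ a b → a + (b - a) ≡ b
    collapse = solve-∀

  sumBelow-suc : ∀ n f → sumBelow (suc n) f ≡ sumBelow n f ℕ.+ f n
  sumBelow-suc n f = begin
    sum (map f (upTo (suc n)))           ≡⟨ cong (sum ∘ map f) (upTo-∷ʳ n) ⟨
    sum (map f (upTo n ∷ʳ n))            ≡⟨ cong sum (map-++ f (upTo n) (n ∷ [])) ⟩
    sum (map f (upTo n) ∷ʳ f n)          ≡⟨ sum-++ (map f (upTo n)) (f n ∷ []) ⟩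
    sumBelow n f ℕ.+ (f n ℕ.+ 0)         ≡⟨ cong (sumBelow n f ℕ.+_) (ℕ.+-identityʳ (f n)) ⟩
    sumBelow n f ℕ.+ f n                 ∎

  sumBelow≡∑ : ∀ n f → + sumBelow n f ≡ ∑ n (λ k → + f k)
  sumBelow≡∑ zero    f = refl
  sumBelow≡∑ (suc n) f = begin
    + sumBelow (suc n) f       ≡⟨ cong +_ (sumBelow-suc n f) ⟩
    + sumBelow n f + + f n     ≡⟨ cong (_+ + f n) (sumBelow≡∑ n f) ⟩
    ∑ n (λ k → + f k) + + f n  ∎

  -- Binomial coefficients and the root of the Apéry summand.

  binom : ℕ → ℕ → ℤ
  binom n k = + (n C k)

  pascal : ∀ n k → binom (suc n) (suc k) ≡ binom n k + binom n (suc k)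
  pascal n k = cong +_ (sym (nCk+nC[k+1]≡[n+1]C[k+1] n k))

  binom≡0 : ∀ {n k} → n ℕ.< k → binom n k ≡ 0ℤ
  binom≡0 n<k = cong +_ (k>n⇒nCk≡0 n<k)

  -- Together with Pascal's rule this is the source of all later shift relations. Each ratio of
  -- neighbours is kept as a product, so it also holds outside the triangle, where entries vanish.
  binom-absorption : ∀ n k → + suc k * binom (suc n) (suc k) ≡ + suc n * binom n k
  binom-absorption zero    zero    = refl
  binom-absorption zero    (suc k) = ℤ.*-zeroʳ (+ suc (suc k))
  binom-absorption (suc n) zero    = begin
    + 1 * binom (suc (suc n)) 1      ≡⟨ cong (+ 1 *_) (pascal (suc n) 0) ⟩
    + 1 * (+ 1 + binom (suc n) 1)    ≡⟨ cong (λ t → + 1 * (+ 1 + t)) (ℤ.*-identityˡ (binom (suc n) 1)) ⟨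
    + 1 * (+ 1 + + 1 * binom (suc n) 1) ≡⟨ cong (λ t → + 1 * (+ 1 + t)) (binom-absorption n zero) ⟩
    + 1 * (+ 1 + + suc n * + 1)      ≡⟨ arith (+ suc n) ⟩
    (+ 1 + + suc n) * + 1            ∎
    where
    arith : ∀ n → + 1 * (+ 1 + n * + 1) ≡ (+ 1 + n) * + 1
    arith = solve-∀
  binom-absorption (suc n) (suc k) = begin
    κ * binom (suc (suc n)) (suc (suc k))               ≡⟨ cong (κ *_) (pascal (suc n) (suc k)) ⟩
    κ * (x + binom (suc n) (suc (suc k)))               ≡⟨ split (+ suc k) x (binom (suc n) (suc (suc k))) ⟩
    + suc k * x + (x + κ * binom (suc n) (suc (suc k))) ≡⟨ cong₂ (λ s t → s + (x + t)) (binom-absorption n k) (binom-absorption n (suc k)) ⟩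
    ν * binom n k + (x + ν * binom n (suc k))           ≡⟨ merge ν x (binom n k) (binom n (suc k)) ⟩
    ν * (binom n k + binom n (suc k)) + x               ≡⟨ cong (λ t → ν * t + x) (pascal n k) ⟨
    ν * x + x                                           ≡⟨ distrib ν x ⟩
    (+ 1 + ν) * x                                       ∎
    where
    κ = + suc (suc k)
    ν = + suc n
    x = binom (suc n) (suc k)
    split : ∀ k x y → (+ 1 + k) * (x + y) ≡ k * x + (x + (+ 1 + k) * y)
    split = solve-∀
    merge : ∀ n x a b → n * a + (x + n * b) ≡ n * (a + b) + x
    merge = solve-∀
    distrib : ∀ n x → n * x + x ≡ (+ 1 + n) * x
    distrib = solve-∀

  binom-nextLower : ∀ n k → + suc k * binom n (suc k) ≡ (+ n - + k) * binom n k
  binom-nextLower n k = begin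
    κ * binom n (suc k)                            ≡⟨ expand κ (binom n k) (binom n (suc k)) ⟩
    κ * (binom n k + binom n (suc k)) - κ * binom n k ≡⟨ cong (λ t → κ * t - κ * binom n k) (pascal n k) ⟨
    κ * binom (suc n) (suc k) - κ * binom n k      ≡⟨ cong (_- κ * binom n k) (binom-absorption n k) ⟩
    + suc n * binom n k - κ * binom n k            ≡⟨ collect (+ n) (+ k) (binom n k) ⟩
    (+ n - + k) * binom n k                        ∎
    where
    κ = + suc k
    expand : ∀ κ a b → κ * b ≡ κ * (a + b) - κ * a
    expand = solve-∀
    collect : ∀ n k x → (+ 1 + n) * x - (+ 1 + k) * x ≡ (n - k) * x
    collect = solve-∀

  binom-nextUpper : ∀ n k → (+ suc n - + k) * binom (suc n) k ≡ + suc n * binom n k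
  binom-nextUpper n zero    = cong (_* + 1) (ℤ.+-identityʳ (+ suc n))
  binom-nextUpper n (suc k) = begin
    (+ suc n - + suc k) * binom (suc n) (suc k)               ≡⟨ cong ((+ suc n - + suc k) *_) (pascal n k) ⟩
    (+ suc n - + suc k) * (binom n k + binom n (suc k))       ≡⟨ split (+ n) (+ k) (binom n k) (binom n (suc k)) ⟩
    (+ n - + k) * binom n k + (+ n - + k) * binom n (suc k)   ≡⟨ cong (_+ (+ n - + k) * binom n (suc k)) (binom-nextLower n k) ⟨
    + suc k * binom n (suc k) + (+ n - + k) * binom n (suc k) ≡⟨ merge (+ n) (+ k) (binom n (suc k)) ⟩
    + suc n * binom n (suc k)                                 ∎
    where
    split : ∀ n k a b → (+ 1 + n - (+ 1 + k)) * (a + b) ≡ (n - k) * a + (n - k) * b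
    split = solve-∀
    merge : ∀ n k b → (+ 1 + k) * b + (n - k) * b ≡ (+ 1 + n) * b
    merge = solve-∀

  -- Up to sign, the coefficients of the shifted Legendre polynomials; A_n is the sum of their
  -- squares. Shift relations are proved before squaring, where the degrees are half as large.
  w : ℕ → ℕ → ℤ
  w n k = binom n k * binom (n ℕ.+ k) k

  w≡0 : ∀ {n k} → n ℕ.< k → w n k ≡ 0ℤ
  w≡0 {n} {k} n<k = cong (_* binom (n ℕ.+ k) k) (binom≡0 n<k)

  w-nextLower : ∀ n k → + suc k * + suc k * w n (suc k) ≡ (+ n - + k) * (+ n + + k + + 1) * w n k
  w-nextLower n k rewrite ℕ.+-suc n k = begin
    κ * κ * (binom n (suc k) * binom (suc (n ℕ.+ k)) (suc k))     ≡⟨ regroup κ (binom n (suc k)) (binom (suc (n ℕ.+ k)) (suc k)) ⟩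
    κ * binom n (suc k) * (κ * binom (suc (n ℕ.+ k)) (suc k))     ≡⟨ cong₂ _*_ (binom-nextLower n k) (binom-absorption (n ℕ.+ k) k) ⟩
    (+ n - + k) * binom n k * (+ suc (n ℕ.+ k) * binom (n ℕ.+ k) k) ≡⟨ ungroup (+ n) (+ k) (binom n k) (binom (n ℕ.+ k) k) ⟩
    (+ n - + k) * (+ n + + k + + 1) * w n k                       ∎
    where
    κ = + suc k
    regroup : ∀ κ a b → κ * κ * (a * b) ≡ κ * a * (κ * b)
    regroup = solve-∀
    ungroup : ∀ n k a b → (n - k) * a * ((+ 1 + (n + k)) * b) ≡ (n - k) * (n + k + + 1) * (a * b)
    ungroup = solve-∀

  binom-diagonalUpper : ∀ n k → + suc n * binom (suc (n ℕ.+ k)) k ≡ + suc (n ℕ.+ k) * binom (n ℕ.+ k) k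
  binom-diagonalUpper n k = trans (cong (_* binom (suc (n ℕ.+ k)) k) (difference (+ n) (+ k))) (binom-nextUpper (n ℕ.+ k) k)
    where
    difference : ∀ n k → + 1 + n ≡ + 1 + (n + k) - k
    difference = solve-∀

  w-nextUpper : ∀ n k → (+ suc n - + k) * w (suc n) k ≡ (+ suc n + + k) * w n k
  w-nextUpper n k = begin
    (+ suc n - + k) * (binom (suc n) k * b₁)   ≡⟨ ℤ.*-assoc (+ suc n - + k) (binom (suc n) k) b₁ ⟨
    (+ suc n - + k) * binom (suc n) k * b₁     ≡⟨ cong (_* b₁) (binom-nextUpper n k) ⟩
    + suc n * binom n k * b₁                   ≡⟨ exchange (+ suc n) (binom n k) b₁ ⟩
    binom n k * (+ suc n * b₁)                 ≡⟨ cong (binom n k *_) (binom-diagonalUpper n k) ⟩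
    binom n k * (+ suc (n ℕ.+ k) * b₀)         ≡⟨ exchange (+ suc (n ℕ.+ k)) (binom n k) b₀ ⟨
    + suc (n ℕ.+ k) * binom n k * b₀           ≡⟨ ℤ.*-assoc (+ suc (n ℕ.+ k)) (binom n k) b₀ ⟩
    (+ suc n + + k) * w n k                    ∎
    where
    b₁ = binom (suc (n ℕ.+ k)) k
    b₀ = binom (n ℕ.+ k) k
    exchange : ∀ a b c → a * b * c ≡ b * (a * c)
    exchange = solve-∀

  w-nextBoth : ∀ n k → + suc k * + suc k * w (suc n) (suc k) ≡ (+ n + + k + + 2) * (+ n + + k + + 1) * w n k
  w-nextBoth n k rewrite ℕ.+-suc n k = begin
    κ * κ * (binom (suc n) (suc k) * binom (suc (suc n+k)) (suc k))   ≡⟨ regroup κ (binom (suc n) (suc k)) (binom (suc (suc n+k)) (suc k)) ⟩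
    κ * binom (suc n) (suc k) * (κ * binom (suc (suc n+k)) (suc k))   ≡⟨ cong₂ _*_ (binom-absorption n k) (binom-absorption (suc n+k) k) ⟩
    + suc n * binom n k * (+ suc (suc n+k) * binom (suc n+k) k)       ≡⟨ exchange (+ suc n) (binom n k) (+ suc (suc n+k)) (binom (suc n+k) k) ⟩
    binom n k * + suc (suc n+k) * (+ suc n * binom (suc n+k) k)       ≡⟨ cong (binom n k * + suc (suc n+k) *_) (binom-diagonalUpper n k) ⟩
    binom n k * + suc (suc n+k) * (+ suc n+k * binom n+k k)           ≡⟨ ungroup (+ n) (+ k) (binom n k) (binom n+k k) ⟩
    (+ n + + k + + 2) * (+ n + + k + + 1) * w n k                     ∎
    where
    κ = + suc k
    n+k = n ℕ.+ k
    regroup : ∀ κ a b → κ * κ * (a * b) ≡ κ * a * (κ * b)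
    regroup = solve-∀
    exchange : ∀ a b c d → a * b * (c * d) ≡ b * c * (a * d)
    exchange = solve-∀
    ungroup : ∀ n k a b → a * (+ 2 + (n + k)) * ((+ 1 + (n + k)) * b) ≡ (n + k + + 2) * (n + k + + 1) * (a * b)
    ungroup = solve-∀

  -- The factor n + k + 1 from `w-nextLower` is what `w-nextUpper` trades for a step to row n + 1.
  -- With `w-nextLower` and `w-nextBoth`, three consecutive rows at k + 1 are thus expressed through
  -- a single value of the middle row at k.
  w-lowerLeft : ∀ n k → + suc k * + suc k * w n (suc k) ≡ (+ n - + k) * (+ suc n - + k) * w (suc n) k
  w-lowerLeft n k = begin
    + suc k * + suc k * w n (suc k)                  ≡⟨ w-nextLower n k ⟩
    (+ n - + k) * (+ n + + k + + 1) * w n k          ≡⟨ regroup (+ n) (+ k) (w n k) ⟩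
    (+ n - + k) * ((+ suc n + + k) * w n k)          ≡⟨ cong ((+ n - + k) *_) (w-nextUpper n k) ⟨
    (+ n - + k) * ((+ suc n - + k) * w (suc n) k)    ≡⟨ ℤ.*-assoc (+ n - + k) (+ suc n - + k) _ ⟨
    (+ n - + k) * (+ suc n - + k) * w (suc n) k      ∎
    where
    regroup : ∀ n k a → (n - k) * (n + k + + 1) * a ≡ (n - k) * ((+ 1 + n + k) * a)
    regroup = solve-∀

  -- The Apéry numbers and their recurrence.

  -- The bound N is free so that several Apéry numbers can share one range of summation, both in the
  -- recurrence and when sums are exchanged.
  apery≡∑ : ∀ n N → n ℕ.< N → + apery n ≡ ∑ N (λ k → w n k * w n k)
  apery≡∑ n N n<N = begin
    + apery n                                       ≡⟨ sumBelow≡∑ (suc n) summand ⟩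
    ∑ (suc n) (λ k → + summand k)                   ≡⟨ ∑-cong (suc n) summand≡w² ⟩
    ∑ (suc n) (λ k → w n k * w n k)                 ≡⟨ ∑-extend (λ k → w n k * w n k) (ℕ.≤⇒≤′ n<N) (λ k n<k → cong (λ t → t * t) (w≡0 n<k)) ⟩
    ∑ N (λ k → w n k * w n k)                       ∎
    where
    summand : ℕ → ℕ
    summand k = ((n C k) ℕ.^ 2) ℕ.* (((n ℕ.+ k) C k) ℕ.^ 2)
    cast : ∀ a b → + ((a ℕ.^ 2) ℕ.* (b ℕ.^ 2)) ≡ + a * + b * (+ a * + b)
    cast a b = begin
      + ((a ℕ.^ 2) ℕ.* (b ℕ.^ 2))               ≡⟨ ℤ.pos-* (a ℕ.^ 2) (b ℕ.^ 2) ⟩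
      + (a ℕ.^ 2) * + (b ℕ.^ 2)                 ≡⟨ cong₂ _*_ (square a) (square b) ⟩
      + a * + a * (+ b * + b)                   ≡⟨ interchange (+ a) (+ b) ⟩
      + a * + b * (+ a * + b)                   ∎
      where
      square : ∀ a → + (a ℕ.^ 2) ≡ + a * + a
      square a = trans (cong (λ t → + (a ℕ.* t)) (ℕ.*-identityʳ a)) (ℤ.pos-* a a)
      interchange : ∀ a b → a * a * (b * b) ≡ a * b * (a * b)
      interchange = solve-∀
    summand≡w² : ∀ k → + summand k ≡ w n k * w n k
    summand≡w² k = cast (n C k) ((n ℕ.+ k) C k)

  -- Coefficient of A_k in the Apéry recurrence.
  middle : ℤ → ℤ
  middle k = (+ 2 * k + + 1) * (+ 17 * k * k + + 17 * k + + 5)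

  cube : ℤ → ℤ
  cube k = k * k * k

  recurrenceTerm : ℕ → ℕ → ℤ
  recurrenceTerm m k = cube (+ m + + 2) * (w (suc (suc m)) k * w (suc (suc m)) k)
    - middle (+ m + + 1) * (w (suc m) k * w (suc m) k)
    + cube (+ m + + 1) * (w m k * w m k)

  -- Zeilberger's creative telescoping certificate for the Apéry numbers.
  certificate : ℕ → ℕ → ℤ
  certificate m k = + 4 * (+ 2 * + m + + 3) * (+ k * (+ 2 * + k + + 1) - (+ 2 * + m + + 3) * (+ 2 * + m + + 3)) * (w (suc m) k * w (suc m) k)

  -- What remains of the telescoping relation at k + 1 once each w, multiplied by (k+1)², has been
  -- rewritten through u = w(m+1, k).
  certificate-identity : ∀ m k u →
    cube (m + + 2) * ((+ 1 + m + k + + 2) * (+ 1 + m + k + + 1) * u * ((+ 1 + m + k + + 2) * (+ 1 + m + k + + 1) * u))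
    - middle (m + + 1) * ((+ 1 + m - k) * (+ 1 + m + k + + 1) * u * ((+ 1 + m - k) * (+ 1 + m + k + + 1) * u))
    + cube (m + + 1) * ((m - k) * (+ 1 + m - k) * u * ((m - k) * (+ 1 + m - k) * u))
    ≡ + 4 * (+ 2 * m + + 3) * ((+ 1 + k) * (+ 2 * (+ 1 + k) + + 1) - (+ 2 * m + + 3) * (+ 2 * m + + 3))
        * ((+ 1 + m - k) * (+ 1 + m + k + + 1) * u * ((+ 1 + m - k) * (+ 1 + m + k + + 1) * u))
      - + 4 * (+ 2 * m + + 3) * (k * (+ 2 * k + + 1) - (+ 2 * m + + 3) * (+ 2 * m + + 3))
        * ((+ 1 + k) * (+ 1 + k) * u * ((+ 1 + k) * (+ 1 + k) * u))
  certificate-identity = unfolded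
    where
    unfolded : ∀ m k u →
      (m + + 2) * (m + + 2) * (m + + 2) * ((+ 1 + m + k + + 2) * (+ 1 + m + k + + 1) * u * ((+ 1 + m + k + + 2) * (+ 1 + m + k + + 1) * u))
      - (+ 2 * (m + + 1) + + 1) * (+ 17 * (m + + 1) * (m + + 1) + + 17 * (m + + 1) + + 5) * ((+ 1 + m - k) * (+ 1 + m + k + + 1) * u * ((+ 1 + m - k) * (+ 1 + m + k + + 1) * u))
      + (m + + 1) * (m + + 1) * (m + + 1) * ((m - k) * (+ 1 + m - k) * u * ((m - k) * (+ 1 + m - k) * u))
      ≡ + 4 * (+ 2 * m + + 3) * ((+ 1 + k) * (+ 2 * (+ 1 + k) + + 1) - (+ 2 * m + + 3) * (+ 2 * m + + 3))
          * ((+ 1 + m - k) * (+ 1 + m + k + + 1) * u * ((+ 1 + m - k) * (+ 1 + m + k + + 1) * u))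
        - + 4 * (+ 2 * m + + 3) * (k * (+ 2 * k + + 1) - (+ 2 * m + + 3) * (+ 2 * m + + 3))
          * ((+ 1 + k) * (+ 1 + k) * u * ((+ 1 + k) * (+ 1 + k) * u))
    unfolded = solve-∀

  *-cancel-square : ∀ k i j → + suc k * + suc k * i ≡ + suc k * + suc k * j → i ≡ j
  *-cancel-square k i j eq = ℤ.*-cancelˡ-≡ κ i j (ℤ.*-cancelˡ-≡ κ (κ * i) (κ * j) (begin
    κ * (κ * i)  ≡⟨ ℤ.*-assoc κ κ i ⟨
    κ * κ * i    ≡⟨ eq ⟩
    κ * κ * j    ≡⟨ ℤ.*-assoc κ κ j ⟩
    κ * (κ * j)  ∎))
    where
    κ = + suc k

  recurrenceTerm-suc : ∀ m k → recurrenceTerm m (suc k) ≡ certificate m (suc k) - certificate m k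
  -- The factor (k+1)⁴ is needed: all terms are squares, and each of the two copies of w absorbs one
  -- (k+1)².
  recurrenceTerm-suc m k = *-cancel-square k (recurrenceTerm m (suc k)) (certificate m (suc k) - certificate m k)
    (*-cancel-square k (κ² * recurrenceTerm m (suc k)) (κ² * (certificate m (suc k) - certificate m k)) (begin
    κ² * (κ² * (α * (w₂ * w₂) - β * (w₁ * w₁) + γ * (w₀ * w₀)))
      ≡⟨ distribute κ² α β γ w₂ w₁ w₀ ⟩
    α * (κ² * w₂ * (κ² * w₂)) - β * (κ² * w₁ * (κ² * w₁)) + γ * (κ² * w₀ * (κ² * w₀))
      ≡⟨ cong₂ _+_ (cong₂ (λ s t → α * (s * s) - β * (t * t)) (w-nextBoth (suc m) k) (w-nextLower (suc m) k))
                   (cong (λ t → γ * (t * t)) (w-lowerLeft m k)) ⟩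
    α * (v₂ * v₂) - β * (v₁ * v₁) + γ * (v₀ * v₀)
      ≡⟨ certificate-identity (+ m) (+ k) u ⟩
    δ * (v₁ * v₁) - ε * (κ² * u * (κ² * u))
      ≡⟨ cong (λ t → δ * (t * t) - ε * (κ² * u * (κ² * u))) (w-nextLower (suc m) k) ⟨
    δ * (κ² * w₁ * (κ² * w₁)) - ε * (κ² * u * (κ² * u))
      ≡⟨ collect κ² δ ε w₁ u ⟩
    κ² * (κ² * (certificate m (suc k) - certificate m k))
      ∎))
    where
    κ² = + suc k * + suc k
    u  = w (suc m) k
    w₀ = w m (suc k)
    w₁ = w (suc m) (suc k)
    w₂ = w (suc (suc m)) (suc k)
    v₀ = (+ m - + k) * (+ suc m - + k) * u
    v₁ = (+ suc m - + k) * (+ suc m + + k + + 1) * u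
    v₂ = (+ suc m + + k + + 2) * (+ suc m + + k + + 1) * u
    α  = cube (+ m + + 2)
    β  = middle (+ m + + 1)
    γ  = cube (+ m + + 1)
    δ  = + 4 * (+ 2 * + m + + 3) * (+ suc k * (+ 2 * + suc k + + 1) - (+ 2 * + m + + 3) * (+ 2 * + m + + 3))
    ε  = + 4 * (+ 2 * + m + + 3) * (+ k * (+ 2 * + k + + 1) - (+ 2 * + m + + 3) * (+ 2 * + m + + 3))
    distribute : ∀ c a b d x y z → c * (c * (a * (x * x) - b * (y * y) + d * (z * z)))
      ≡ a * (c * x * (c * x)) - b * (c * y * (c * y)) + d * (c * z * (c * z))
    distribute = solve-∀
    collect : ∀ c a b x y → a * (c * x * (c * x)) - b * (c * y * (c * y)) ≡ c * (c * (a * (x * x) - b * (y * y)))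
    collect = solve-∀

  recurrenceTerm-zero : ∀ m → recurrenceTerm m 0 ≡ certificate m 0
  recurrenceTerm-zero m = expand (+ m)
    where
    expand : ∀ m → (m + + 2) * (m + + 2) * (m + + 2) * (+ 1 * + 1 * (+ 1 * + 1))
      - (+ 2 * (m + + 1) + + 1) * (+ 17 * (m + + 1) * (m + + 1) + + 17 * (m + + 1) + + 5) * (+ 1 * + 1 * (+ 1 * + 1))
      + (m + + 1) * (m + + 1) * (m + + 1) * (+ 1 * + 1 * (+ 1 * + 1))
      ≡ + 4 * (+ 2 * m + + 3) * (+ 0 * (+ 2 * + 0 + + 1) - (+ 2 * m + + 3) * (+ 2 * m + + 3)) * (+ 1 * + 1 * (+ 1 * + 1))
    expand = solve-∀

  A : ℕ → ℤ
  A n = + apery n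

  apery-recurrence : ∀ m → cube (+ m + + 2) * A (suc (suc m)) - middle (+ m + + 1) * A (suc m) + cube (+ m + + 1) * A m ≡ 0ℤ
  apery-recurrence m = begin
    α * A (suc (suc m)) - β * A (suc m) + γ * A m
      ≡⟨ cong₂ _+_ (cong₂ (λ s t → α * s - β * t) (apery≡∑ (suc (suc m)) N ℕ.≤-refl) (apery≡∑ (suc m) N (ℕ.n≤1+n _)))
                   (cong (γ *_) (apery≡∑ m N (ℕ.≤-trans (ℕ.n≤1+n _) (ℕ.n≤1+n _)))) ⟩
    α * ∑ N (W (suc (suc m))) - β * ∑ N (W (suc m)) + γ * ∑ N (W m)
      ≡⟨ cong₂ _+_ (cong (λ t → α * ∑ N (W (suc (suc m))) + t) (ℤ.neg-distribˡ-* β (∑ N (W (suc m))))) refl ⟩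
    α * ∑ N (W (suc (suc m))) + - β * ∑ N (W (suc m)) + γ * ∑ N (W m)
      ≡⟨ linear N α (- β) γ (W (suc (suc m))) (W (suc m)) (W m) ⟨
    ∑ N (λ k → α * W (suc (suc m)) k + - β * W (suc m) k + γ * W m k)
      ≡⟨ ∑-cong N (λ k → cong (λ t → α * W (suc (suc m)) k + t + γ * W m k) (sym (ℤ.neg-distribˡ-* β (W (suc m) k)))) ⟩
    ∑ N (recurrenceTerm m)
      ≡⟨ ∑-telescope (recurrenceTerm m) (certificate m) (recurrenceTerm-zero m) (recurrenceTerm-suc m) (suc (suc m)) ⟩
    certificate m (suc (suc m))
      ≡⟨ cong (λ t → ε * (t * t)) (w≡0 {suc m} {suc (suc m)} ℕ.≤-refl) ⟩
    ε * (0ℤ * 0ℤ)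
      ≡⟨ ℤ.*-zeroʳ ε ⟩
    0ℤ ∎
    where
    -- The range covers the supports of all three rows, and its last index k = m + 2 lies beyond the
    -- support of row m + 1, so the certificate vanishes there.
    N = suc (suc (suc m))
    α = cube (+ m + + 2)
    β = middle (+ m + + 1)
    γ = cube (+ m + + 1)
    ε = + 4 * (+ 2 * + m + + 3) * (+ suc (suc m) * (+ 2 * + suc (suc m) + + 1) - (+ 2 * + m + + 3) * (+ 2 * + m + + 3))
    W : ℕ → ℕ → ℤ
    W n k = w n k * w n k
    linear : ∀ n a b c f g h → ∑ n (λ k → a * f k + b * g k + c * h k) ≡ a * ∑ n f + b * ∑ n g + c * ∑ n h
    linear n a b c f g h = begin
      ∑ n (λ k → a * f k + b * g k + c * h k)
        ≡⟨ ∑-+ n (λ k → a * f k + b * g k) (λ k → c * h k) ⟩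
      ∑ n (λ k → a * f k + b * g k) + ∑ n (λ k → c * h k)
        ≡⟨ cong₂ _+_ (∑-+ n (λ k → a * f k) (λ k → b * g k)) (∑-*ˡ n c h) ⟩
      ∑ n (λ k → a * f k) + ∑ n (λ k → b * g k) + c * ∑ n h
        ≡⟨ cong₂ (λ s t → s + t + c * ∑ n h) (∑-*ˡ n a f) (∑-*ˡ n b g) ⟩
      a * ∑ n f + b * ∑ n g + c * ∑ n h ∎

  -- Summation by parts against the recurrence.

  odd : ℕ → ℤ
  odd k = + 2 * + k + + 1

  -- ξ k stands for the value at k − 1 of the multiplier x, so that no predecessor occurs.
  adjoint : (ℕ → ℤ) → ℕ → ℤ
  adjoint ξ k = cube (+ k) * ξ k - middle (+ k) * ξ (suc k) + cube (+ k + + 1) * ξ (suc (suc k))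

  -- In the induction step the two sides differ by `ξ (suc (suc n))` times the recurrence. There is
  -- no lower boundary term because k³ vanishes at k = 0, where the recurrence degenerates to A_1 =
  -- 5 A_0. The cube in the upper boundary term is the leading coefficient of the recurrence, and
  -- becomes the modulus.
  ∑-adjoint : ∀ ξ n → ∑ (suc n) (λ k → adjoint ξ k * A k)
    ≡ cube (+ suc n) * (ξ (suc (suc n)) * A n - ξ (suc n) * A (suc n))
  ∑-adjoint ξ zero = base (ξ 0) (ξ 1) (ξ 2)
    where
    base : ∀ a b c → + 0 + (+ 0 * + 0 * + 0 * a - (+ 2 * + 0 + + 1) * (+ 17 * + 0 * + 0 + + 17 * + 0 + + 5) * b
      + (+ 0 + + 1) * (+ 0 + + 1) * (+ 0 + + 1) * c) * + 1 ≡ + 1 * + 1 * + 1 * (c * + 1 - b * + 5)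
    base = solve-∀
  ∑-adjoint ξ (suc n) = begin
    ∑ (suc n) (λ k → adjoint ξ k * A k) + adjoint ξ (suc n) * A₁
      ≡⟨ cong (_+ adjoint ξ (suc n) * A₁) (∑-adjoint ξ n) ⟩
    μ * (x₂ * A₀ - x₁ * A₁) + (μ * x₁ - middle (+ suc n) * x₂ + cube (+ suc n + + 1) * x₃) * A₁
      ≡⟨ cong (λ t → μ * (x₂ * A₀ - x₁ * A₁) + (μ * x₁ - middle t * x₂ + cube (+ suc n + + 1) * x₃) * A₁) (ℤ.+-comm (+ 1) (+ n)) ⟩
    μ * (x₂ * A₀ - x₁ * A₁) + (μ * x₁ - β * x₂ + cube (+ suc n + + 1) * x₃) * A₁
      ≡⟨ cong₂ (λ s t → s * (x₂ * A₀ - x₁ * A₁) + (s * x₁ - β * x₂ + t * x₃) * A₁) (cong cube (ℤ.+-comm (+ 1) (+ n))) (cong cube (shift (+ n))) ⟩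
    γ * (x₂ * A₀ - x₁ * A₁) + (γ * x₁ - β * x₂ + α * x₃) * A₁
      ≡⟨ regroup α β γ A₀ A₁ A₂ x₁ x₂ x₃ ⟩
    α * (x₃ * A₁ - x₂ * A₂) + x₂ * (α * A₂ - β * A₁ + γ * A₀)
      ≡⟨ cong₂ (λ s t → cube s * (x₃ * A₁ - x₂ * A₂) + x₂ * t) (ℤ.+-comm (+ n) (+ 2)) (apery-recurrence n) ⟩
    cube (+ suc (suc n)) * (x₃ * A₁ - x₂ * A₂) + x₂ * 0ℤ
      ≡⟨ dropZero (cube (+ suc (suc n)) * (x₃ * A₁ - x₂ * A₂)) x₂ ⟩
    cube (+ suc (suc n)) * (x₃ * A₁ - x₂ * A₂) ∎
    where
    A₀ = A n
    A₁ = A (suc n)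
    A₂ = A (suc (suc n))
    x₁ = ξ (suc n)
    x₂ = ξ (suc (suc n))
    x₃ = ξ (suc (suc (suc n)))
    μ = cube (+ suc n)
    α = cube (+ n + + 2)
    β = middle (+ n + + 1)
    γ = cube (+ n + + 1)
    shift : ∀ n → + 1 + n + + 1 ≡ n + + 2
    shift = solve-∀
    dropZero : ∀ a b → a + b * + 0 ≡ a
    dropZero = solve-∀
    regroup : ∀ α β γ a₀ a₁ a₂ x₁ x₂ x₃ → γ * (x₂ * a₀ - x₁ * a₁) + (γ * x₁ - β * x₂ + α * x₃) * a₁
      ≡ α * (x₃ * a₁ - x₂ * a₂) + x₂ * (α * a₂ - β * a₁ + γ * a₀)
    regroup = solve-∀

  -- Odd moments modulo n³.

  moment : (ℤ → ℤ) → ℕ → ℤ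
  moment f n = ∑ n (λ k → odd k * f (odd k * odd k) * A k)

  oddSum : ℕ → ℤ
  oddSum n = ∑ n (λ k → odd k * A k)

  -- The order of quantifiers matters: M and c are fixed before n, so one constant serves all
  -- primes. The power of 2 stands for a denominator of c.
  Reducible : (ℤ → ℤ) → Set
  Reducible f = Σ ℕ λ M → Σ ℤ λ c → ∀ n → Σ ℤ λ z → (+ 2) ^ M * moment f n ≡ c * oddSum n + cube (+ n) * z

  moment-cong : ∀ {f g} → (∀ v → f v ≡ g v) → ∀ n → moment f n ≡ moment g n
  moment-cong f≗g n = ∑-cong n (λ k → cong (λ t → odd k * t * A k) (f≗g (odd k * odd k)))

  moment-+ : ∀ f g n → moment (λ v → f v + g v) n ≡ moment f n + moment g n
  moment-+ f g n = trans
    (∑-cong n (λ k → distrib (odd k) (f (odd k * odd k)) (g (odd k * odd k)) (A k)))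
    (∑-+ n (λ k → odd k * f (odd k * odd k) * A k) (λ k → odd k * g (odd k * odd k) * A k))
    where
    distrib : ∀ y a b t → y * (a + b) * t ≡ y * a * t + y * b * t
    distrib = solve-∀

  moment-*ˡ : ∀ c f n → moment (λ v → c * f v) n ≡ c * moment f n
  moment-*ˡ c f n = trans
    (∑-cong n (λ k → assoc c (odd k) (f (odd k * odd k)) (A k)))
    (∑-*ˡ n c (λ k → odd k * f (odd k * odd k) * A k))
    where
    assoc : ∀ c y a t → y * (c * a) * t ≡ c * (y * a * t)
    assoc = solve-∀

  reducible-cong : ∀ {f g} → (∀ v → f v ≡ g v) → Reducible f → Reducible g
  reducible-cong f≗g (M , c , h) = M , c , λ n → let (z , eq) = h n in
    z , trans (cong ((+ 2) ^ M *_) (sym (moment-cong f≗g n))) eq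

  reducible-zero : Reducible (λ _ → 0ℤ)
  reducible-zero = 0 , 0ℤ , λ n → 0ℤ , (begin
    (+ 1) * moment (λ _ → 0ℤ) n       ≡⟨ ℤ.*-identityˡ (moment (λ _ → 0ℤ) n) ⟩
    moment (λ _ → 0ℤ) n               ≡⟨ moment-*ˡ 0ℤ (λ _ → 0ℤ) n ⟩
    0ℤ * moment (λ _ → 0ℤ) n          ≡⟨ vanish (moment (λ _ → 0ℤ) n) (oddSum n) (cube (+ n)) ⟩
    0ℤ * oddSum n + cube (+ n) * 0ℤ   ∎)
    where
    vanish : ∀ a b c → + 0 * a ≡ + 0 * b + c * + 0
    vanish = solve-∀

  reducible-one : Reducible (λ _ → 1ℤ)
  reducible-one = 0 , 1ℤ , λ n → 0ℤ , (begin
    + 1 * moment (λ _ → 1ℤ) n        ≡⟨ cong (+ 1 *_) (∑-cong n (λ k → cong (_* A k) (ℤ.*-identityʳ (odd k)))) ⟩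
    + 1 * oddSum n                   ≡⟨ addZero (+ 1 * oddSum n) (cube (+ n)) ⟩
    + 1 * oddSum n + cube (+ n) * 0ℤ ∎)
    where
    addZero : ∀ a b → a ≡ a + b * + 0
    addZero = solve-∀

  reducible-+ : ∀ f g → Reducible f → Reducible g → Reducible (λ v → f v + g v)
  reducible-+ f g (M , c , h) (N , d , k) = M ℕ.+ N , (+ 2) ^ N * c + (+ 2) ^ M * d , λ n →
    let (x , eqx) = h n ; (y , eqy) = k n in
    (+ 2) ^ N * x + (+ 2) ^ M * y , (begin
    (+ 2) ^ (M ℕ.+ N) * moment (λ v → f v + g v) n
      ≡⟨ cong₂ _*_ (ℤ.^-distribˡ-+-* (+ 2) M N) (moment-+ f g n) ⟩
    (+ 2) ^ M * (+ 2) ^ N * (moment f n + moment g n)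
      ≡⟨ distrib ((+ 2) ^ M) ((+ 2) ^ N) (moment f n) (moment g n) ⟩
    (+ 2) ^ N * ((+ 2) ^ M * moment f n) + (+ 2) ^ M * ((+ 2) ^ N * moment g n)
      ≡⟨ cong₂ (λ s t → (+ 2) ^ N * s + (+ 2) ^ M * t) eqx eqy ⟩
    (+ 2) ^ N * (c * oddSum n + cube (+ n) * x) + (+ 2) ^ M * (d * oddSum n + cube (+ n) * y)
      ≡⟨ collect ((+ 2) ^ M) ((+ 2) ^ N) c d (oddSum n) (cube (+ n)) x y ⟩
    ((+ 2) ^ N * c + (+ 2) ^ M * d) * oddSum n + cube (+ n) * ((+ 2) ^ N * x + (+ 2) ^ M * y) ∎)
    where
    distrib : ∀ m n a b → m * n * (a + b) ≡ n * (m * a) + m * (n * b)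
    distrib = solve-∀
    collect : ∀ m n c d s q x y → n * (c * s + q * x) + m * (d * s + q * y) ≡ (n * c + m * d) * s + q * (n * x + m * y)
    collect = solve-∀

  reducible-*ˡ : ∀ a f → Reducible f → Reducible (λ v → a * f v)
  reducible-*ˡ a f (M , c , h) = M , a * c , λ n → let (z , eq) = h n in
    a * z , (begin
    (+ 2) ^ M * moment (λ v → a * f v) n        ≡⟨ cong ((+ 2) ^ M *_) (moment-*ˡ a f n) ⟩
    (+ 2) ^ M * (a * moment f n)                ≡⟨ commute ((+ 2) ^ M) a (moment f n) ⟩
    a * ((+ 2) ^ M * moment f n)                ≡⟨ cong (a *_) eq ⟩
    a * (c * oddSum n + cube (+ n) * z)         ≡⟨ distrib a c (oddSum n) (cube (+ n)) z ⟩
    a * c * oddSum n + cube (+ n) * (a * z)     ∎)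
    where
    commute : ∀ m a x → m * (a * x) ≡ a * (m * x)
    commute = solve-∀
    distrib : ∀ a c s q z → a * (c * s + q * z) ≡ a * c * s + q * (a * z)
    distrib = solve-∀

  reducible-16 : ∀ {f} → Reducible (λ v → + 16 * f v) → Reducible f
  reducible-16 {f} (M , c , h) = M ℕ.+ 4 , c , λ n → let (z , eq) = h n in
    z , (begin
    (+ 2) ^ (M ℕ.+ 4) * moment f n              ≡⟨ cong (_* moment f n) (ℤ.^-distribˡ-+-* (+ 2) M 4) ⟩
    (+ 2) ^ M * + 16 * moment f n               ≡⟨ ℤ.*-assoc ((+ 2) ^ M) (+ 16) (moment f n) ⟩
    (+ 2) ^ M * (+ 16 * moment f n)             ≡⟨ cong ((+ 2) ^ M *_) (moment-*ˡ (+ 16) f n) ⟨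
    (+ 2) ^ M * moment (λ v → + 16 * f v) n     ≡⟨ eq ⟩
    c * oddSum n + cube (+ n) * z               ∎)

  -- The span of v^0, ..., v^(d-1), given by derivations instead of coefficients. `Reducible` is
  -- closed under every constructor other than `monomial`, so it passes from monomials to all of the
  -- span by induction on the derivation.
  data Degree< (d : ℕ) : (ℤ → ℤ) → Set where
    monomial : ∀ {i} → i ℕ.< d → Degree< d (_^ i)
    zeroᵖ    : Degree< d (λ _ → 0ℤ)
    addᵖ     : ∀ {f g} → Degree< d f → Degree< d g → Degree< d (λ v → f v + g v)
    scale    : ∀ a {f} → Degree< d f → Degree< d (λ v → a * f v)
    cong-≗   : ∀ {f g} → (∀ v → f v ≡ g v) → Degree< d f → Degree< d g

  degree<-suc : ∀ {d f} → Degree< d f → Degree< (suc d) f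
  degree<-suc (monomial i<d)  = monomial (ℕ.m<n⇒m<1+n i<d)
  degree<-suc zeroᵖ           = zeroᵖ
  degree<-suc (addᵖ p q)      = addᵖ (degree<-suc p) (degree<-suc q)
  degree<-suc (scale a p)     = scale a (degree<-suc p)
  degree<-suc (cong-≗ f≗g p)  = cong-≗ f≗g (degree<-suc p)

  degree<-*v : ∀ {d f} → Degree< d f → Degree< (suc d) (λ v → v * f v)
  degree<-*v (monomial i<d)  = monomial (s≤s i<d)
  degree<-*v zeroᵖ           = cong-≗ (λ v → sym (ℤ.*-zeroʳ v)) zeroᵖ
  degree<-*v (addᵖ {f} {g} p q) = cong-≗ (λ v → sym (ℤ.*-distribˡ-+ v (f v) (g v))) (addᵖ (degree<-*v p) (degree<-*v q))
  degree<-*v (scale a {f} p) = cong-≗ (λ v → commute a v (f v)) (scale a (degree<-*v p))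
    where
    commute : ∀ a v x → a * (v * x) ≡ v * (a * x)
    commute = solve-∀
  degree<-*v (cong-≗ f≗g p)  = cong-≗ (λ v → cong (v *_) (f≗g v)) (degree<-*v p)

  reducible-degree< : ∀ {d} → (∀ i → i ℕ.< d → Reducible (_^ i)) → ∀ {f} → Degree< d f → Reducible f
  reducible-degree< h (monomial i<d)  = h _ i<d
  reducible-degree< h zeroᵖ           = reducible-zero
  reducible-degree< h (addᵖ {f} {g} p q) = reducible-+ f g (reducible-degree< h p) (reducible-degree< h q)
  reducible-degree< h (scale a {f} p) = reducible-*ˡ a f (reducible-degree< h p)
  reducible-degree< h (cong-≗ f≗g p)  = reducible-cong f≗g (reducible-degree< h p)

  -- The adjoint image of even powers, and the descent in degree.

  -- (y ± 2)^(2s) = evenPart s (y²) ± oddPart s (y²) · y.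
  evenPart oddPart : ℕ → ℤ → ℤ
  evenPart zero    v = 1ℤ
  evenPart (suc s) v = v * evenPart s v + + 4 * evenPart s v + + 4 * (v * oddPart s v)
  oddPart zero    v = 0ℤ
  oddPart (suc s) v = v * oddPart s v + + 4 * oddPart s v + + 4 * evenPart s v

  squarePow-above : ∀ s y → ((y + + 2) * (y + + 2)) ^ s ≡ evenPart s (y * y) + oddPart s (y * y) * y
  squarePow-above zero    y = refl
  squarePow-above (suc s) y = trans (cong ((y + + 2) * (y + + 2) *_) (squarePow-above s y)) (expand y (evenPart s (y * y)) (oddPart s (y * y)))
    where
    expand : ∀ y a b → (y + + 2) * (y + + 2) * (a + b * y)
      ≡ y * y * a + + 4 * a + + 4 * (y * y * b) + (y * y * b + + 4 * b + + 4 * a) * y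
    expand = solve-∀

  squarePow-below : ∀ s y → ((y - + 2) * (y - + 2)) ^ s ≡ evenPart s (y * y) - oddPart s (y * y) * y
  squarePow-below zero    y = refl
  squarePow-below (suc s) y = trans (cong ((y - + 2) * (y - + 2) *_) (squarePow-below s y)) (expand y (evenPart s (y * y)) (oddPart s (y * y)))
    where
    expand : ∀ y a b → (y - + 2) * (y - + 2) * (a - b * y)
      ≡ y * y * a + + 4 * a + + 4 * (y * y * b) - (y * y * b + + 4 * b + + 4 * a) * y
    expand = solve-∀

  -- As (y+2)^(2s) is monic in y of degree 2s, its even part is monic of degree s in v = y², while
  -- its odd part divided by y has degree at most s - 1. The three bounds feed each other in the
  -- recursion on s.
  evenPart-leading : ∀ s → Degree< s (λ v → evenPart s v - v ^ s)
  oddPart-degree   : ∀ s → Degree< s (oddPart s)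
  evenPart-degree  : ∀ s → Degree< (suc s) (evenPart s)

  evenPart-leading zero    = zeroᵖ
  evenPart-leading (suc s) = cong-≗ (λ v → regroup v (evenPart s v) (oddPart s v) (v ^ s))
    (addᵖ (addᵖ (degree<-*v (evenPart-leading s)) (scale (+ 4) (evenPart-degree s))) (scale (+ 4) (degree<-*v (oddPart-degree s))))
    where
    regroup : ∀ v a b t → v * (a - t) + + 4 * a + + 4 * (v * b) ≡ v * a + + 4 * a + + 4 * (v * b) - v * t
    regroup = solve-∀

  oddPart-degree zero    = zeroᵖ
  oddPart-degree (suc s) = addᵖ (addᵖ (degree<-*v (oddPart-degree s)) (scale (+ 4) (degree<-suc (oddPart-degree s)))) (scale (+ 4) (evenPart-degree s))

  evenPart-degree s = cong-≗ (λ v → cancel (evenPart s v) (v ^ s)) (addᵖ (degree<-suc (evenPart-leading s)) (monomial (ℕ.n<1+n s)))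
    where
    cancel : ∀ a t → a - t + t ≡ a
    cancel = solve-∀

  -- The adjoint operator applied to (2k+1)^(2s), up to the factor (2k+1)/4, as a polynomial in v = (2k+1)².
  adjointImage : ℕ → ℤ → ℤ
  adjointImage s v = (v + + 3) * evenPart s v + (+ 3 * v + + 1) * oddPart s v - (+ 17 * v + + 3) * v ^ s

  -- The multiplier (2k+1)^(2s) taken at k - 1, as the indexing of `adjoint` requires.
  shiftedPow : ℕ → ℕ → ℤ
  shiftedPow s k = ((+ 2 * + k - + 1) * (+ 2 * + k - + 1)) ^ s

  -- With y = 2k + 1 one has 8k³ = (y-1)³, 8(k+1)³ = (y+1)³ and 4 `middle k` = y(17y² + 3).
  -- Replacing y by -y swaps the outer terms up to sign, so only odd powers of y survive.
  adjoint-shiftedPow : ∀ s k → + 4 * adjoint (shiftedPow s) k ≡ odd k * adjointImage s (odd k * odd k)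
  adjoint-shiftedPow s k = begin
    + 4 * (cube (+ k) * shiftedPow s k - middle (+ k) * shiftedPow s (suc k) + cube (+ k + + 1) * shiftedPow s (suc (suc k)))
      ≡⟨ cong (+ 4 *_) (cong₂ _+_ (cong₂ (λ s t → cube (+ k) * s - middle (+ k) * t) below at) (cong (cube (+ k + + 1) *_) above)) ⟩
    + 4 * (cube (+ k) * (a - b * odd k) - middle (+ k) * t + cube (+ k + + 1) * (a + b * odd k))
      ≡⟨ expand (+ k) a b t ⟩
    odd k * adjointImage s (odd k * odd k) ∎
    where
    y² = odd k * odd k
    a = evenPart s y²
    b = oddPart s y²
    t = y² ^ s
    eq₀ : ∀ k → + 2 * k - + 1 ≡ + 2 * k + + 1 - + 2
    eq₀ = solve-∀
    eq₁ : ∀ k → + 2 * (+ 1 + k) - + 1 ≡ + 2 * k + + 1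
    eq₁ = solve-∀
    eq₂ : ∀ k → + 2 * (+ 2 + k) - + 1 ≡ + 2 * k + + 1 + + 2
    eq₂ = solve-∀
    below : shiftedPow s k ≡ a - b * odd k
    below = trans (cong (λ t → (t * t) ^ s) (eq₀ (+ k))) (squarePow-below s (odd k))
    at : shiftedPow s (suc k) ≡ t
    at = cong (λ t → (t * t) ^ s) (eq₁ (+ k))
    above : shiftedPow s (suc (suc k)) ≡ a + b * odd k
    above = trans (cong (λ t → (t * t) ^ s) (eq₂ (+ k))) (squarePow-above s (odd k))
    expand : ∀ k a b t → + 4 * (k * k * k * (a - b * (+ 2 * k + + 1)) - (+ 2 * k + + 1) * (+ 17 * k * k + + 17 * k + + 5) * t
      + (k + + 1) * (k + + 1) * (k + + 1) * (a + b * (+ 2 * k + + 1)))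
      ≡ (+ 2 * k + + 1) * (((+ 2 * k + + 1) * (+ 2 * k + + 1) + + 3) * a + (+ 3 * ((+ 2 * k + + 1) * (+ 2 * k + + 1)) + + 1) * b
        - (+ 17 * ((+ 2 * k + + 1) * (+ 2 * k + + 1)) + + 3) * t)
    expand = solve-∀

  reducible-adjointImage : ∀ s → Reducible (adjointImage s)
  reducible-adjointImage s = 0 , 0ℤ , λ where
      zero    → 0ℤ , refl
      (suc n) → + 4 * boundary n , (begin
        + 1 * moment (adjointImage s) (suc n)
          ≡⟨ ℤ.*-identityˡ (moment (adjointImage s) (suc n)) ⟩
        moment (adjointImage s) (suc n)
          ≡⟨ ∑-cong (suc n) (λ k → trans (cong (_* A k) (sym (adjoint-shiftedPow s k))) (ℤ.*-assoc (+ 4) (adjoint (shiftedPow s) k) (A k))) ⟩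
        ∑ (suc n) (λ k → + 4 * (adjoint (shiftedPow s) k * A k))
          ≡⟨ ∑-*ˡ (suc n) (+ 4) (λ k → adjoint (shiftedPow s) k * A k) ⟩
        + 4 * ∑ (suc n) (λ k → adjoint (shiftedPow s) k * A k)
          ≡⟨ cong (+ 4 *_) (∑-adjoint (shiftedPow s) n) ⟩
        + 4 * (cube (+ suc n) * boundary n)
          ≡⟨ commute (cube (+ suc n)) (boundary n) (oddSum (suc n)) ⟩
        0ℤ * oddSum (suc n) + cube (+ suc n) * (+ 4 * boundary n) ∎)
    where
    boundary : ℕ → ℤ
    boundary n = shiftedPow s (suc (suc n)) * A n - shiftedPow s (suc n) * A (suc n)
    commute : ∀ q x s → + 4 * (q * x) ≡ + 0 * s + q * (+ 4 * x)
    commute = solve-∀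

  -- The coefficient of v^(s+1) is 1 - 17: the 1 comes from v times the monic even part, the 17 from
  -- the middle term, and the odd part is too short to contribute.
  adjointImage-leading : ∀ s → Degree< (suc s) (λ v → adjointImage s v + + 16 * v ^ suc s)
  adjointImage-leading s = cong-≗ (λ v → regroup v (evenPart s v) (oddPart s v) (v ^ s))
    (addᵖ (addᵖ (degree<-*v (evenPart-leading s)) (scale (+ 3) (evenPart-degree s)))
          (addᵖ (addᵖ (scale (+ 3) (degree<-*v (oddPart-degree s))) (degree<-suc (oddPart-degree s))) (scale (- + 3) (monomial (ℕ.n<1+n s)))))
    where
    regroup : ∀ v a b t → v * (a - t) + + 3 * a + (+ 3 * (v * b) + b + - + 3 * t)
      ≡ (v + + 3) * a + (+ 3 * v + + 1) * b - (+ 17 * v + + 3) * t + + 16 * (v * t)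
    regroup = solve-∀

  -- 16 v^(s+1) is a polynomial of degree at most s minus the adjoint image, whose moments are
  -- multiples of n³.
  reducible-pow-suc : ∀ s → (∀ i → i ℕ.< suc s → Reducible (_^ i)) → Reducible (_^ suc s)
  reducible-pow-suc s h = reducible-16 {_^ suc s} (reducible-cong (λ v → cancel (adjointImage s v) (+ 16 * v ^ suc s))
    (reducible-+ (λ v → adjointImage s v + + 16 * v ^ suc s) (λ v → - + 1 * adjointImage s v)
      (reducible-degree< h (adjointImage-leading s))
      (reducible-*ˡ (- + 1) (adjointImage s) (reducible-adjointImage s))))
    where
    cancel : ∀ p q → p + q + - + 1 * p ≡ q
    cancel = solve-∀

  reducible-pow-< : ∀ d i → i ℕ.< d → Reducible (_^ i)
  reducible-pow-< (suc d) i i<1+d with ℕ.m<1+n⇒m<n∨m≡n i<1+d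
  ... | inj₁ i<d = reducible-pow-< d i i<d
  reducible-pow-< (suc zero)    .zero    i<1+d | inj₂ refl = reducible-one
  reducible-pow-< (suc (suc s)) .(suc s) i<1+d | inj₂ refl = reducible-pow-suc s (reducible-pow-< (suc s))

  reducible-pow : ∀ r → Reducible (_^ r)
  reducible-pow r = reducible-pow-< (suc r) r (ℕ.n<1+n r)

  -- Divisibility by powers of a prime.

  euclidsLemma-ℤ : ∀ {p} → Prime p → ∀ a x → + p ∣ a * x → + p ∣ a ⊎ + p ∣ x
  euclidsLemma-ℤ {p} pp a x p∣ax with euclidsLemma (abs a) (abs x) pp (subst (p ℕ.∣_) (ℤ.abs-* a x) (∣⇒∣ᵤ p∣ax))
  ... | inj₁ p∣a = inj₁ (∣ᵤ⇒∣ p∣a)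
  ... | inj₂ p∣x = inj₂ (∣ᵤ⇒∣ p∣x)

  prime-^≢0 : ∀ {p} → Prime p → ∀ k → ℕ.NonZero (abs ((+ p) ^ k))
  prime-^≢0 {p} pp k = ≢-nonZero (ℕ.≢-nonZero⁻¹ p {{prime⇒nonZero pp}} ∘ ℤ.+-injective ∘ ℤ.i^n≡0⇒i≡0 (+ p) k)

  -- Induction on k: the smaller exponent gives x = t p^k, and cancelling p^k leaves p ∣ a t, where
  -- Euclid's lemma applies. This replaces inverting a modulo p^k.
  prime-^-cancel : ∀ {p} → Prime p → ∀ {a} → ¬ + p ∣ a → ∀ k x → (+ p) ^ k ∣ a * x → (+ p) ^ k ∣ x
  prime-^-cancel         pp     p∤a zero    x _ = divides x (sym (ℤ.*-identityʳ x))
  prime-^-cancel {p} pp {a} p∤a (suc k) x (divides s ax≡) = lift (prime-^-cancel pp p∤a k x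
      (divides (s * + p) (trans ax≡ (sym (ℤ.*-assoc s (+ p) q)))))
    where
    q = (+ p) ^ k
    lift : q ∣ x → + p * q ∣ x
    lift (divides t refl) with euclidsLemma-ℤ pp a t (divides s (ℤ.*-cancelʳ-≡ (a * t) (s * + p) q {{prime-^≢0 pp k}} (begin
      a * t * q      ≡⟨ ℤ.*-assoc a t q ⟩
      a * (t * q)    ≡⟨ ax≡ ⟩
      s * (+ p * q)  ≡⟨ ℤ.*-assoc s (+ p) q ⟨
      s * + p * q    ∎)))
    ... | inj₁ p∣a              = contradiction p∣a p∤a
    ... | inj₂ (divides u refl) = divides u (ℤ.*-assoc u (+ p) q)

  ∤-between : ∀ {p n} → 0 ℕ.< n → n ℕ.< p → ¬ + p ∣ + n
  ∤-between {p} {suc n} _ n<p p∣n = ℕ.<⇒≱ n<p (ℕ.∣⇒≤ (∣⇒∣ᵤ p∣n))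

  -- Each induction step strips the first and the last term as one pair and shifts f; the central
  -- term is what is left.
  ∑-symmetric : ∀ m f d → (∀ i j → i ℕ.+ j ≡ m ℕ.+ m → i ℕ.< m → d ∣ f i + f j) → d ∣ ∑ (suc (m ℕ.+ m)) f - f m
  ∑-symmetric zero    f d _ = divides 0ℤ (cancel (f 0) d)
    where
    cancel : ∀ x d → + 0 + x - x ≡ + 0 * d
    cancel = solve-∀
  ∑-symmetric (suc m) f d h rewrite ℕ.+-suc m m = subst (d ∣_) regrouped
    (∣m∣n⇒∣m+n (h 0 (suc (suc (m ℕ.+ m))) refl (s≤s z≤n))
               (∑-symmetric m (f ∘ suc) d (λ i j i+j≡2m i<m → h (suc i) (suc j) (cong suc (trans (ℕ.+-suc i j) (cong suc i+j≡2m))) (s≤s i<m))))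
    where
    last = f (suc (suc (m ℕ.+ m)))
    inner = ∑ (suc (m ℕ.+ m)) (f ∘ suc)
    regroup : ∀ a b c d → a + b + (c - d) ≡ a + c + b - d
    regroup = solve-∀
    regrouped : f 0 + last + (inner - f (suc m)) ≡ ∑ (suc (suc (m ℕ.+ m))) f + last - f (suc m)
    regrouped = trans (regroup (f 0) last inner (f (suc m))) (cong (λ t → t + last - f (suc m)) (sym (∑-headTail (suc (m ℕ.+ m)) f)))

  -- The first odd moment modulo p³.

  column : ℕ → ℕ → ℤ
  column n j = ∑ n (λ k → odd k * (w k j * w k j))

  -- By `w-nextUpper` the right side grows by ((n+1+j)² - (n-j)²) w(n,j)², and this difference of
  -- squares factors as (2n+1)(2j+1).
  column-closed : ∀ n j → odd j * column n j ≡ (+ n - + j) * w n j * ((+ n - + j) * w n j)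
  column-closed zero zero    = refl
  column-closed zero (suc j) = begin
    odd (suc j) * 0ℤ                      ≡⟨ ℤ.*-zeroʳ (odd (suc j)) ⟩
    0ℤ                                    ≡⟨ cong (λ t → t * t) (ℤ.*-zeroʳ (+ 0 - + suc j)) ⟨
    (+ 0 - + suc j) * 0ℤ * ((+ 0 - + suc j) * 0ℤ)
      ≡⟨ cong (λ t → (+ 0 - + suc j) * t * ((+ 0 - + suc j) * t)) (w≡0 {0} {suc j} (s≤s z≤n)) ⟨
    (+ 0 - + suc j) * w 0 (suc j) * ((+ 0 - + suc j) * w 0 (suc j)) ∎
  column-closed (suc n) j = begin
    odd j * (column n j + odd n * (w n j * w n j))
      ≡⟨ ℤ.*-distribˡ-+ (odd j) (column n j) (odd n * (w n j * w n j)) ⟩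
    odd j * column n j + odd j * (odd n * (w n j * w n j))
      ≡⟨ cong (_+ odd j * (odd n * (w n j * w n j))) (column-closed n j) ⟩
    (+ n - + j) * w n j * ((+ n - + j) * w n j) + odd j * (odd n * (w n j * w n j))
      ≡⟨ differenceOfSquares (+ n) (+ j) (w n j) ⟩
    (+ suc n + + j) * w n j * ((+ suc n + + j) * w n j)
      ≡⟨ cong (λ t → t * t) (w-nextUpper n j) ⟨
    (+ suc n - + j) * w (suc n) j * ((+ suc n - + j) * w (suc n) j) ∎
    where
    differenceOfSquares : ∀ n j x → (n - j) * x * ((n - j) * x) + (+ 2 * j + + 1) * ((+ 2 * n + + 1) * (x * x))
      ≡ (+ 1 + n + j) * x * ((+ 1 + n + j) * x)
    differenceOfSquares = solve-∀

  oddSum≡∑column : ∀ n → oddSum n ≡ ∑ n (column n)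
  oddSum≡∑column n = begin
    ∑ n (λ k → odd k * A k)                           ≡⟨ ∑-cong-< n (λ k k<n → cong (odd k *_) (apery≡∑ k n k<n)) ⟩
    ∑ n (λ k → odd k * ∑ n (λ j → w k j * w k j))     ≡⟨ ∑-cong n (λ k → ∑-*ˡ n (odd k) (λ j → w k j * w k j)) ⟨
    ∑ n (λ k → ∑ n (λ j → odd k * (w k j * w k j)))   ≡⟨ ∑-swap n n (λ k j → odd k * (w k j * w k j)) ⟩
    ∑ n (column n)                                    ∎

  -- central q j = ∏_{1 ≤ i ≤ j} (p² − i²)/i² for p = suc q, hence ±1 modulo p² when j < p.
  central : ℕ → ℕ → ℤ
  central q j = binom q j * binom (suc q ℕ.+ j) j

  -- Absorption in the first binomial pulls out one factor p = q + 1; squaring gives the p² of every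
  -- column.
  central-w : ∀ q j → (+ suc q - + j) * w (suc q) j ≡ + suc q * central q j
  central-w q j = begin
    (+ suc q - + j) * (binom (suc q) j * b)  ≡⟨ ℤ.*-assoc (+ suc q - + j) (binom (suc q) j) b ⟨
    (+ suc q - + j) * binom (suc q) j * b    ≡⟨ cong (_* b) (binom-nextUpper q j) ⟩
    + suc q * binom q j * b                  ≡⟨ ℤ.*-assoc (+ suc q) (binom q j) b ⟩
    + suc q * central q j                    ∎
    where
    b = binom (suc q ℕ.+ j) j

  column-central : ∀ q j → odd j * column (suc q) j ≡ + suc q * central q j * (+ suc q * central q j)
  column-central q j = trans (column-closed (suc q) j) (cong (λ t → t * t) (central-w q j))

  -- (q-j)(q+2+j) = p² - (j+1)² with p = q + 1, so consecutive values are opposite up to a multiple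
  -- of p².
  central-suc : ∀ q j → + suc j * (+ suc j * (central q (suc j) + central q j)) ≡ central q j * (+ suc q * (+ suc q * 1ℤ))
  central-suc q j rewrite ℕ.+-suc q j = begin
    κ * (κ * (binom q (suc j) * binom (suc (suc (q ℕ.+ j))) (suc j) + a * b))
      ≡⟨ regroup κ (binom q (suc j)) (binom (suc (suc (q ℕ.+ j))) (suc j)) (a * b) ⟩
    κ * binom q (suc j) * (κ * binom (suc (suc (q ℕ.+ j))) (suc j)) + κ * κ * (a * b)
      ≡⟨ cong₂ (λ s t → s * t + κ * κ * (a * b)) (binom-nextLower q j) (binom-absorption (suc (q ℕ.+ j)) j) ⟩
    (+ q - + j) * a * ((+ 2 + (+ q + + j)) * b) + κ * κ * (a * b)
      ≡⟨ collect (+ q) (+ j) a b ⟩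
    a * b * (+ suc q * (+ suc q * 1ℤ)) ∎
    where
    κ = + suc j
    a = binom q j
    b = binom (suc (q ℕ.+ j)) j
    regroup : ∀ k x y z → k * (k * (x * y + z)) ≡ k * x * (k * y) + k * k * z
    regroup = solve-∀
    collect : ∀ q j a b → (q - j) * a * ((+ 2 + (q + j)) * b) + (+ 1 + j) * (+ 1 + j) * (a * b)
      ≡ a * b * ((+ 1 + q) * ((+ 1 + q) * + 1))
    collect = solve-∀

  -- Passing to squares removes the alternating sign: p² divides D_(j+1) + D_j, hence also D_(j+1)²
  -- - D_j². The bound on j keeps the cancelled factors prime to p.
  central²≡1 : ∀ q → Prime (suc q) → ∀ j → j ℕ.< suc q → (+ suc q) ^ 2 ∣ central q j * central q j - + 1
  central²≡1 q pp zero    _     = divides 0ℤ refl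
  central²≡1 q pp (suc j) 1+j<p = subst ((+ suc q) ^ 2 ∣_) (telescope (central q (suc j)) (central q j))
    (∣m∣n⇒∣m+n (∣m⇒∣m*n (central q (suc j) - central q j) p²∣sum) (central²≡1 q pp j (ℕ.<⇒≤ 1+j<p)))
    where
    p∤1+j : ¬ + suc q ∣ + suc j
    p∤1+j = ∤-between (s≤s z≤n) 1+j<p
    p²∣sum : (+ suc q) ^ 2 ∣ central q (suc j) + central q j
    p²∣sum = prime-^-cancel pp p∤1+j 2 (central q (suc j) + central q j)
      (prime-^-cancel pp p∤1+j 2 (+ suc j * (central q (suc j) + central q j))
        (divides (central q j) (central-suc q j)))
    telescope : ∀ x y → (x + y) * (x - y) + (y * y - + 1) ≡ x * x - + 1
    telescope = solve-∀

  -- Here 2m + 1 is p itself, so one of the two factors p is lost and the column equals p D²; the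
  -- congruence for D² modulo p² then gains back one power.
  column-middle : ∀ m → Prime (suc (m ℕ.+ m)) → (+ suc (m ℕ.+ m)) ^ 3 ∣ column (suc (m ℕ.+ m)) m - + suc (m ℕ.+ m)
  column-middle m pp with central²≡1 (m ℕ.+ m) pp m (s≤s (ℕ.m≤m+n m m))
  ... | divides e eq = divides e (begin
    T - P                            ≡⟨ cong (_- P) T≡ ⟩
    P * (D * D) - P                  ≡⟨ factor P D ⟩
    P * (D * D - + 1)                ≡⟨ cong (P *_) eq ⟩
    P * (e * (P * (P * 1ℤ)))         ≡⟨ regroup P e ⟩
    e * (P * (P * (P * 1ℤ)))         ∎)
    where
    P = + suc (m ℕ.+ m)
    T = column (suc (m ℕ.+ m)) m
    D = central (m ℕ.+ m) m
    factor : ∀ p d → p * (d * d) - p ≡ p * (d * d - + 1)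
    factor = solve-∀
    regroup : ∀ p e → p * (e * (p * (p * + 1))) ≡ e * (p * (p * (p * + 1)))
    regroup = solve-∀
    double : ∀ m → + 1 + (m + m) ≡ + 2 * m + + 1
    double = solve-∀
    assoc : ∀ p d → p * d * (p * d) ≡ p * (p * (d * d))
    assoc = solve-∀
    T≡ : T ≡ P * (D * D)
    T≡ = ℤ.*-cancelˡ-≡ P T (P * (D * D)) (begin
      P * T                ≡⟨ cong (_* T) (double (+ m)) ⟩
      odd m * T            ≡⟨ column-central (m ℕ.+ m) m ⟩
      P * D * (P * D)      ≡⟨ assoc P D ⟩
      P * (P * (D * D))    ∎)

  -- The integer t stands in for the fraction D_j²/(2j+1).
  column-div : ∀ q → Prime (suc q) → ∀ j → ¬ + suc q ∣ odd j
    → Σ ℤ λ t → column (suc q) j ≡ t * (+ suc q) ^ 2 × odd j * t ≡ central q j * central q j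
  column-div q pp j p∤odd = quotientOf (prime-^-cancel pp p∤odd 2 (column (suc q) j)
      (divides (D * D) (trans (column-central q j) (square P D))))
    where
    P = + suc q
    D = central q j
    square : ∀ p d → p * d * (p * d) ≡ d * d * (p * (p * + 1))
    square = solve-∀
    quotientOf : P ^ 2 ∣ column (suc q) j → Σ ℤ λ t → column (suc q) j ≡ t * P ^ 2 × odd j * t ≡ D * D
    quotientOf (divides t eq) = t , eq , ℤ.*-cancelʳ-≡ (odd j * t) (D * D) (P ^ 2) {{prime-^≢0 pp 2}} (begin
      odd j * t * P ^ 2          ≡⟨ ℤ.*-assoc (odd j) t (P ^ 2) ⟩
      odd j * (t * P ^ 2)        ≡⟨ cong (odd j *_) eq ⟨
      odd j * column (suc q) j   ≡⟨ column-central q j ⟩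
      P * D * (P * D)            ≡⟨ square P D ⟩
      D * D * P ^ 2              ∎)

  -- From i + j = p - 1 it follows that (2i+1) + (2j+1) = 2p, so the two denominators are opposite
  -- modulo p while both numerators are 1. The third power of p comes from this sum of fractions.
  -- The bound 2i < q puts 2i + 1 strictly between 0 and p.
  column-pair : ∀ q → Prime (suc q) → ∀ i j → i ℕ.+ j ≡ q → i ℕ.+ i ℕ.< q → (+ suc q) ^ 3 ∣ column (suc q) i + column (suc q) j
  column-pair q pp i j refl 2i<q = combine (column-div q pp i p∤odd-i) (column-div q pp j p∤odd-j)
                                           (central²≡1 q pp i (s≤s (ℕ.m≤m+n i j))) (central²≡1 q pp j (s≤s (ℕ.m≤n+m j i)))
    where
    P = + suc q
    double : ∀ i → + 2 * i + + 1 ≡ + 1 + (i + i)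
    double = solve-∀
    p∤odd-i : ¬ P ∣ odd i
    p∤odd-i = subst (λ t → ¬ P ∣ t) (sym (double (+ i))) (∤-between (s≤s z≤n) (s≤s 2i<q))
    reflect : ∀ i j → + 2 * (+ 1 + (i + j)) - (+ 2 * j + + 1) ≡ + 2 * i + + 1
    reflect = solve-∀
    p∤odd-j : ¬ P ∣ odd j
    p∤odd-j p∣odd-j = p∤odd-i (subst (P ∣_) (reflect (+ i) (+ j)) (∣m∣n⇒∣m-n (divides (+ 2) refl) p∣odd-j))
    combine : (Σ ℤ λ t → column (suc q) i ≡ t * P ^ 2 × odd i * t ≡ central q i * central q i)
      → (Σ ℤ λ t → column (suc q) j ≡ t * P ^ 2 × odd j * t ≡ central q j * central q j)
      → P ^ 2 ∣ central q i * central q i - + 1 → P ^ 2 ∣ central q j * central q j - + 1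
      → P ^ 3 ∣ column (suc q) i + column (suc q) j
    combine (s , eqs , odd-s) (t , eqt , odd-t) (divides a eqa) (divides b eqb)
      -- Writing 2i + 1 as 2p - (2j+1) in front of t turns (2i+1)(s+t) into D_i² - D_j² + 2pt; only
      -- one factor p is available, owing to the last term.
      with prime-^-cancel pp p∤odd-i 1 (s + t) (divides (a * P - b * P + + 2 * t) (begin
        odd i * (s + t)
          ≡⟨ regroup (+ i) (+ j) s t ⟩
        odd i * s - + 1 - (odd j * t - + 1) + + 2 * P * t
          ≡⟨ cong₂ (λ x y → x - + 1 - (y - + 1) + + 2 * P * t) odd-s odd-t ⟩
        central q i * central q i - + 1 - (central q j * central q j - + 1) + + 2 * P * t
          ≡⟨ cong₂ (λ x y → x - y + + 2 * P * t) eqa eqb ⟩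
        a * P ^ 2 - b * P ^ 2 + + 2 * P * t
          ≡⟨ factor a b P t ⟩
        (a * P - b * P + + 2 * t) * P ^ 1 ∎))
      where
      regroup : ∀ i j s t → (+ 2 * i + + 1) * (s + t)
        ≡ (+ 2 * i + + 1) * s - + 1 - ((+ 2 * j + + 1) * t - + 1) + + 2 * (+ 1 + (i + j)) * t
      regroup = solve-∀
      factor : ∀ a b p t → a * (p * (p * + 1)) - b * (p * (p * + 1)) + + 2 * p * t ≡ (a * p - b * p + + 2 * t) * (p * + 1)
      factor = solve-∀
    ... | divides u eqst = divides u (begin
      column (suc q) i + column (suc q) j   ≡⟨ cong₂ _+_ eqs eqt ⟩
      s * P ^ 2 + t * P ^ 2                 ≡⟨ ℤ.*-distribʳ-+ (P ^ 2) s t ⟨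
      (s + t) * P ^ 2                       ≡⟨ cong (_* P ^ 2) eqst ⟩
      u * P ^ 1 * P ^ 2                     ≡⟨ assoc u P ⟩
      u * P ^ 3                             ∎)
      where
      assoc : ∀ u p → u * (p * + 1) * (p * (p * + 1)) ≡ u * (p * (p * (p * + 1)))
      assoc = solve-∀

  oddSum-odd-prime : ∀ m → Prime (suc (m ℕ.+ m)) → (+ suc (m ℕ.+ m)) ^ 3 ∣ oddSum (suc (m ℕ.+ m)) - + suc (m ℕ.+ m)
  oddSum-odd-prime m pp = subst (P ^ 3 ∣_) combined
    (∣m∣n⇒∣m+n (∑-symmetric m (column p) (P ^ 3) (λ i j i+j≡2m i<m → column-pair (m ℕ.+ m) pp i j i+j≡2m (ℕ.+-mono-< i<m i<m)))
               (column-middle m pp))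
    where
    p = suc (m ℕ.+ m)
    P = + p
    cancel : ∀ a b c → a - b + (b - c) ≡ a - c
    cancel = solve-∀
    combined : ∑ p (column p) - column p m + (column p m - P) ≡ oddSum p - P
    combined = trans (cancel (∑ p (column p)) (column p m) P) (cong (_- P) (sym (oddSum≡∑column p)))

  halve : ∀ n → Σ ℕ λ m → n ≡ m ℕ.+ m ⊎ n ≡ suc (m ℕ.+ m)
  halve zero = 0 , inj₁ refl
  halve (suc n) with halve n
  ... | m , inj₁ n≡2m   = m , inj₂ (cong suc n≡2m)
  ... | m , inj₂ n≡1+2m = suc m , inj₁ (trans (cong suc n≡1+2m) (cong suc (sym (ℕ.+-suc m m))))

  prime>2⇒2∤ : ∀ {p} → Prime p → p ℕ.> 2 → ¬ 2 ℕ.∣ p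
  prime>2⇒2∤ pp p>2 2∣p with prime⇒irreducible pp 2∣p
  ... | inj₂ refl = ℕ.<-irrefl refl p>2

  oddSum-prime : ∀ {p} → Prime p → p ℕ.> 2 → (+ p) ^ 3 ∣ oddSum p - + p
  oddSum-prime {p} pp p>2 with halve p
  ... | m , inj₁ refl = contradiction (ℕ.divides m (trans (cong (m ℕ.+_) (sym (ℕ.+-identityʳ m))) (ℕ.*-comm 2 m))) (prime>2⇒2∤ pp p>2)
  ... | m , inj₂ refl = oddSum-odd-prime m pp

open IntegerSums
open import Data.Nat using (_>_; _*_; _^_; _+_)

-- Transfer to natural and rational numbers.

pos-^ : ∀ a n → + (a ^ n) ≡ (+ a) ℤ.^ n
pos-^ a zero    = refl
pos-^ a (suc n) = trans (ℤ.pos-* a (a ^ n)) (cong (λ t → + a ℤ.* t) (pos-^ a n))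

weightedSum≡moment : ∀ r n → + sumBelow n (λ k → ((2 * k + 1) ^ (2 * r + 1)) * apery k) ≡ moment (ℤ._^ r) n
weightedSum≡moment r n = trans (sumBelow≡∑ n (λ k → ((2 * k + 1) ^ (2 * r + 1)) * apery k)) (∑-cong n term)
  where
  power : ∀ k → + ((2 * k + 1) ^ (2 * r + 1)) ≡ odd k ℤ.* (odd k ℤ.* odd k) ℤ.^ r
  power k = begin
    + ((2 * k + 1) ^ (2 * r + 1))             ≡⟨ pos-^ (2 * k + 1) (2 * r + 1) ⟩
    (+ (2 * k + 1)) ℤ.^ (2 * r + 1)           ≡⟨ cong₂ ℤ._^_ (cong (λ t → t ℤ.+ + 1) (ℤ.pos-* 2 k)) (ℕ.+-comm (2 * r) 1) ⟩
    odd k ℤ.* odd k ℤ.^ (2 * r)               ≡⟨ cong (λ t → odd k ℤ.* t) (ℤ.^-*-assoc (odd k) 2 r) ⟨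
    odd k ℤ.* (odd k ℤ.^ 2) ℤ.^ r             ≡⟨ cong (λ t → odd k ℤ.* (odd k ℤ.* t) ℤ.^ r) (ℤ.*-identityʳ (odd k)) ⟩
    odd k ℤ.* (odd k ℤ.* odd k) ℤ.^ r         ∎
  term : ∀ k → + (((2 * k + 1) ^ (2 * r + 1)) * apery k) ≡ odd k ℤ.* (odd k ℤ.* odd k) ℤ.^ r ℤ.* A k
  term k = trans (ℤ.pos-* ((2 * k + 1) ^ (2 * r + 1)) (apery k)) (cong (λ t → t ℤ.* A k) (power k))

prime∤2^ : ∀ {p} → Prime p → p > 2 → ∀ M → ¬ p ℕ.∣ 2 ^ M
prime∤2^ pp p>2 zero    p∣1 = ℕ.<⇒≱ (ℕ.<⇒≤ p>2) (ℕ.∣⇒≤ p∣1)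
prime∤2^ pp p>2 (suc M) p∣2^1+M with euclidsLemma 2 (2 ^ M) pp p∣2^1+M
... | inj₁ p∣2  = ℕ.<⇒≱ p>2 (ℕ.∣⇒≤ p∣2)
... | inj₂ p∣2^M = prime∤2^ pp p>2 M p∣2^M

cross-multiply : ∀ x {z d} → ℚ.toℚᵘ x ℚᵘ.≃ mkℚᵘ z d → ↥ x ℤ.* + suc d ≡ z ℤ.* ↧ x
cross-multiply (mkℚ _ _ _) (*≡* eq) = eq

-- Numerator and denominator of x in lowest terms are coprime, so cross-multiplication forces the
-- reduced denominator into any other one.
denominator-∣ : ∀ x {z d} → ℚ.toℚᵘ x ℚᵘ.≃ mkℚᵘ z d → ↧ₙ x ℕ.∣ suc d
denominator-∣ x@(mkℚ n d-1 coprime) {z} {d} (*≡* eq) = Coprime.coprime-divisor (Coprime.sym (Coprime.recompute coprime))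
  (ℕ.divides ℤ.∣ z ∣ (begin
    ℤ.∣ n ∣ * suc d          ≡⟨ ℤ.abs-* n (+ suc d) ⟨
    ℤ.∣ n ℤ.* + suc d ∣      ≡⟨ cong ℤ.∣_∣ eq ⟩
    ℤ.∣ z ℤ.* + suc d-1 ∣    ≡⟨ ℤ.abs-* z (+ suc d-1) ⟩
    ℤ.∣ z ∣ * suc d-1        ∎))

isPAdicInt : ∀ {p} x {z d} → ℚ.toℚᵘ x ℚᵘ.≃ mkℚᵘ z d → ¬ p ℕ.∣ suc d → IsPAdicInt p x
isPAdicInt x x≃ p∤d p∣↧x = p∤d (ℕ.∣-trans p∣↧x (denominator-∣ x x≃))

numerator-∣ : ∀ {p} → Prime p → ∀ x {z d} → ℚ.toℚᵘ x ℚᵘ.≃ mkℚᵘ z d → ¬ p ℕ.∣ suc d → ∀ k →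
  (+ p) ℤ.^ k ℤ.∣ z → p ^ k ℕ.∣ ℤ.∣ ↥ x ∣
numerator-∣ {p} pp x {z} {d} x≃ p∤d k p^k∣z = subst (ℕ._∣ ℤ.∣ ↥ x ∣) (cong ℤ.∣_∣ (sym (pos-^ p k)))
  (∣⇒∣ᵤ (prime-^-cancel pp {+ suc d} (p∤d ∘ ∣⇒∣ᵤ) k (↥ x)
    (subst ((+ p) ℤ.^ k ℤ.∣_) (trans (sym (cross-multiply x x≃)) (ℤ.*-comm (↥ x) (+ suc d))) (∣m⇒∣m*n (↧ x) p^k∣z))))

-- An unreduced fraction with visible numerator and denominator; divisibility is checked on it and
-- then carried over to lowest terms.
toℚᵘ-difference : ∀ S c d p z → + S ℤ.* + suc d ℤ.- c ℤ.* + p ≡ z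
  → ℚ.toℚᵘ (ℕtoℚ S ℚ.- (c ℚ./ suc d) ℚ.* ℕtoℚ p) ℚᵘ.≃ mkℚᵘ z d
toℚᵘ-difference S c d p z eq = ℚᵘ.≃-trans homomorphic (*≡* (begin
    (+ S ℤ.* + (suc d * 1) ℤ.+ (ℤ.- (c ℤ.* + p)) ℤ.* + 1) ℤ.* + suc d
      ≡⟨ cong₂ (λ s t → (+ S ℤ.* + s ℤ.+ t) ℤ.* + suc d) (ℕ.*-identityʳ (suc d)) (ℤ.*-identityʳ (ℤ.- (c ℤ.* + p))) ⟩
    (+ S ℤ.* + suc d ℤ.- c ℤ.* + p) ℤ.* + suc d
      ≡⟨ cong₂ (λ s t → s ℤ.* + t) eq (sym (trans (ℕ.*-identityˡ (suc d * 1)) (ℕ.*-identityʳ (suc d)))) ⟩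
    z ℤ.* + (1 * (suc d * 1)) ∎))
  where
  homomorphic : ℚ.toℚᵘ (ℕtoℚ S ℚ.- (c ℚ./ suc d) ℚ.* ℕtoℚ p) ℚᵘ.≃ mkℚᵘ (+ S) 0 ℚᵘ.- mkℚᵘ c d ℚᵘ.* mkℚᵘ (+ p) 0
  homomorphic = ℚᵘ.≃-trans (ℚ.toℚᵘ-homo-+ (ℕtoℚ S) (ℚ.- (c/d ℚ.* ℕtoℚ p)))
    (ℚᵘ.+-cong (ℚ.toℚᵘ-fromℚᵘ (mkℚᵘ (+ S) 0))
      (ℚᵘ.≃-trans (ℚ.toℚᵘ-homo‿- (c/d ℚ.* ℕtoℚ p))
        (ℚᵘ.-‿cong (ℚᵘ.≃-trans (ℚ.toℚᵘ-homo-* c/d (ℕtoℚ p))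
          (ℚᵘ.*-cong (ℚ.toℚᵘ-fromℚᵘ (mkℚᵘ c d)) (ℚ.toℚᵘ-fromℚᵘ (mkℚᵘ (+ p) 0)))))))
    where
    c/d = c ℚ./ suc d

weightedSum-mod-p³ : ∀ r → Σ ℕ λ M → Σ ℤ λ c → ∀ p → Prime p → p > 3 →
  (+ p) ℤ.^ 3 ℤ.∣ + sumBelow p (λ k → ((2 * k + 1) ^ (2 * r + 1)) * apery k) ℤ.* + (2 ^ M) ℤ.- c ℤ.* + p
weightedSum-mod-p³ r with reducible-pow r
... | M , c , reduce = M , c , λ p pp p>3 → let (z , eq) = reduce p in combine p z eq (oddSum-prime pp (ℕ.<⇒≤ p>3))
  where
  combine : ∀ p z → (+ 2) ℤ.^ M ℤ.* moment (ℤ._^ r) p ≡ c ℤ.* oddSum p ℤ.+ cube (+ p) ℤ.* z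
    → (+ p) ℤ.^ 3 ℤ.∣ oddSum p ℤ.- + p
    → (+ p) ℤ.^ 3 ℤ.∣ + sumBelow p (λ k → ((2 * k + 1) ^ (2 * r + 1)) * apery k) ℤ.* + (2 ^ M) ℤ.- c ℤ.* + p
  combine p z eq (divides a eqa) = divides (c ℤ.* a ℤ.+ z) (begin
    + sumBelow p (λ k → ((2 * k + 1) ^ (2 * r + 1)) * apery k) ℤ.* + (2 ^ M) ℤ.- c ℤ.* P
      ≡⟨ cong₂ (λ s t → s ℤ.* t ℤ.- c ℤ.* P) (weightedSum≡moment r p) (pos-^ 2 M) ⟩
    moment (ℤ._^ r) p ℤ.* (+ 2) ℤ.^ M ℤ.- c ℤ.* P
      ≡⟨ cong (λ t → t ℤ.- c ℤ.* P) (trans (ℤ.*-comm (moment (ℤ._^ r) p) ((+ 2) ℤ.^ M)) eq) ⟩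
    c ℤ.* oddSum p ℤ.+ cube P ℤ.* z ℤ.- c ℤ.* P
      ≡⟨ collect c (oddSum p) P z ⟩
    c ℤ.* (oddSum p ℤ.- P) ℤ.+ cube P ℤ.* z
      ≡⟨ cong (λ t → c ℤ.* t ℤ.+ cube P ℤ.* z) eqa ⟩
    c ℤ.* (a ℤ.* P ℤ.^ 3) ℤ.+ cube P ℤ.* z
      ≡⟨ factor c a P z ⟩
    (c ℤ.* a ℤ.+ z) ℤ.* P ℤ.^ 3 ∎)
    where
    P = + p
    collect : ∀ c s p z → c ℤ.* s ℤ.+ p ℤ.* p ℤ.* p ℤ.* z ℤ.- c ℤ.* p ≡ c ℤ.* (s ℤ.- p) ℤ.+ p ℤ.* p ℤ.* p ℤ.* z
    collect = solve-∀
    factor : ∀ c a p z → c ℤ.* (a ℤ.* (p ℤ.* (p ℤ.* (p ℤ.* + 1)))) ℤ.+ p ℤ.* p ℤ.* p ℤ.* z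
      ≡ (c ℤ.* a ℤ.+ z) ℤ.* (p ℤ.* (p ℤ.* (p ℤ.* + 1)))
    factor = solve-∀

theorem3p2 : (r : ℕ) → Σ ℚ (λ c → (p : ℕ) → Prime p → p > 3 → IsPAdicInt p c × CongModPow p 3 (ℕtoℚ (sumBelow p (λ k → ((2 * k + 1) ^ (2 * r + 1)) * apery k))) (c ℚ.* ℕtoℚ p))
-- The constant is c_r = c / 2^M.
theorem3p2 r = let (M , c , h) = weightedSum-mod-p³ r in rational c (2 ^ M) {{ℕ.m^n≢0 2 M}} (λ p pp p>3 → prime∤2^ pp (ℕ.<⇒≤ p>3) M , h p pp p>3)
  where
  rational : ∀ c D .{{_ : ℕ.NonZero D}} →
    (∀ p → Prime p → p > 3 → ¬ p ℕ.∣ D ×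
      (+ p) ℤ.^ 3 ℤ.∣ + sumBelow p (λ k → ((2 * k + 1) ^ (2 * r + 1)) * apery k) ℤ.* + D ℤ.- c ℤ.* + p) →
    Σ ℚ (λ c → (p : ℕ) → Prime p → p > 3 → IsPAdicInt p c × CongModPow p 3 (ℕtoℚ (sumBelow p (λ k → ((2 * k + 1) ^ (2 * r + 1)) * apery k))) (c ℚ.* ℕtoℚ p))
  rational c (suc d) h = c ℚ./ suc d , λ p pp p>3 →
    let S = sumBelow p (λ k → ((2 * k + 1) ^ (2 * r + 1)) * apery k)
        cᵣ = c ℚ./ suc d
        (p∤d , p³∣) = h p pp p>3
        difference = toℚᵘ-difference S c d p (+ S ℤ.* + suc d ℤ.- c ℤ.* + p) refl
    in isPAdicInt cᵣ (ℚ.toℚᵘ-fromℚᵘ (mkℚᵘ c d)) p∤d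
     , numerator-∣ pp (ℕtoℚ S ℚ.- cᵣ ℚ.* ℕtoℚ p) difference p∤d 3 p³∣
     , isPAdicInt (ℕtoℚ S ℚ.- cᵣ ℚ.* ℕtoℚ p) difference p∤d
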